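{- Consider the deterministic procedure RecycledFY (defined in the context), which maps each $z\in\{0,1,\ldots,119\}$ to a $3$-subset of $\{0,1,2,3,4,5\}$. Over the $120$ inputs $z$, each of the subsets $\{0,3,4\},\{1,2,3\},\{1,2,5\},\{1,4,5\}$ is output exactly $8$ times, each of the subsets $\{0,2,3\},\{0,2,5\},\{0,4,5\},\{1,3,4\}$ is output exactly $4$ times, and each of the remaining $12$ three-element subsets of $\{0,\ldots,5\}$ is output exactly $6$ times. In particular, when $z$ is uniform on $\{0,\ldots,119\}$, the output is not uniformly distributed over the $20$ three-element subsets.
   Context: Procedure RecycledFY (partial Fisher–Yates shuffle choosing $3$ of $6$ items with immediate insertion-rank recycling), on input $z\in\{0,\ldots,119\}$: initialize the array $a=[a_0,\ldots,a_5]=[0,1,2,3,4,5]$ and $(Z,M)=(z,120)$. For $i=0,1,2$ in order: (1) set $x=Z\bmod(6-i)$ and then update $(Z,M)\gets(\lfloor Z/(6-i)\rfloor,\,M/(6-i))$ (the division of $M$ is always exact); (2) swap the array entries $a_i$ and $a_{i+x}$; (3) let $d$ be the zero-based rank of $a_i$ in $\{a_0,\ldots,a_i\}$, i.e. the number of elements of that set that are smaller than $a_i$; (4) update $(Z,M)\gets((i+1)Z+d,\,(i+1)M)$. The output is the set $\{a_0,a_1,a_2\}$ after the three rounds. -}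

module Defs where

open import Data.Fin using (Fin; toℕ; fromℕ<; _<?_)
open import Data.Fin.Patterns using (0F; 1F; 2F; 3F; 4F; 5F)
open import Data.Fin.Properties using (toℕ<n)
open import Data.Fin.Subset using (Subset; ⁅_⁆; _∪_; _∩_; ⋃; ∣_∣)
open import Data.Integer using (+_)
open import Data.List as List using (List; []; _∷_; length; filter; foldl; allFin)
open import Data.List.Membership.Propositional using (_∈_; _∉_)
open import Data.List.Relation.Unary.Unique.Propositional using (Unique)
open import Data.Nat using (ℕ; suc; _+_; _*_; _∸_; _<_; _/_; _%_; NonZero; >-nonZero)
open import Data.Nat.DivMod using (m%n<n)
open import Data.Nat.Properties using (m<n⇒0<n∸m; +-monoʳ-<; m+[n∸m]≡n; <⇒≤)
open import Data.Product using (_×_; ∃-syntax)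
open import Data.Rational as ℚ using (ℚ)
open import Data.Vec using (Vec; lookup; tabulate; toList; _[_]≔_)
open import Data.Vec.Properties using (≡-dec)
import Data.Bool as Bool
open import Function.Bundles using (_⇔_)
open import Relation.Binary.Definitions using (DecidableEquality)
open import Relation.Binary.PropositionalEquality using (_≡_; subst)
open import Relation.Nullary.Decidable using (does)

Array : Set
Array = Vec (Fin 6) 6

record State : Set where
  constructor ⟨_,_,_⟩
  field
    array : Array
    Z M   : ℕ

open State public

initial : ℕ → State
initial z = ⟨ tabulate (λ j → j) , z , 120 ⟩

swap : Array → Fin 6 → Fin 6 → Array
swap a j k = (a [ j ]≔ lookup a k) [ k ]≔ lookup a j

prefixSet : Array → ℕ → Subset 6
prefixSet a k = ⋃ (List.map ⁅_⁆ (List.take k (toList a)))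

below : Fin 6 → Subset 6
below v = tabulate (λ w → does (w <? v))

rank : Array → Fin 6 → ℕ
rank a i = ∣ prefixSet a (suc (toℕ i)) ∩ below (lookup a i) ∣

6∸i-nonZero : (i : Fin 6) → NonZero (6 ∸ toℕ i)
6∸i-nonZero i = >-nonZero (m<n⇒0<n∸m (toℕ<n i))

i+x<6 : (i : Fin 6) {x : ℕ} → x < 6 ∸ toℕ i → toℕ i + x < 6
i+x<6 i {x} x<6∸i =
  subst (toℕ i + x <_) (m+[n∸m]≡n (<⇒≤ (toℕ<n i))) (+-monoʳ-< (toℕ i) x<6∸i)

-- M runs through 120, 20, 20, 4, 8, 2, 6, so the floor division of M below
-- is exact in each of the three rounds.
round : State → Fin 6 → State
round ⟨ a , Z , M ⟩ i = ⟨ a′ , suc n * Z′ + d , suc n * M′ ⟩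
  where
  instance
    nonZero : NonZero (6 ∸ toℕ i)
    nonZero = 6∸i-nonZero i

  n  = toℕ i
  x  = Z % (6 ∸ n)
  Z′ = Z / (6 ∸ n)
  M′ = M / (6 ∸ n)
  a′ = swap a i (fromℕ< (i+x<6 i (m%n<n Z (6 ∸ n))))
  d  = rank a′ i

recycledFY : Fin 120 → Subset 6
recycledFY z =
  prefixSet (array (foldl round (initial (toℕ z)) (0F ∷ 1F ∷ 2F ∷ []))) 3

_≟ₛ_ : DecidableEquality (Subset 6)
_≟ₛ_ = ≡-dec Bool._≟_

timesOutput : Subset 6 → ℕ
timesOutput S = length (filter (λ z → recycledFY z ≟ₛ S) (allFin 120))

-- The probability of the output S when z is uniform on Fin 120.
outputProbability : Subset 6 → ℚ
outputProbability S = + timesOutput S ℚ./ 120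

ThreeElement : Subset 6 → Set
ThreeElement S = ∣ S ∣ ≡ 3

｛_,_,_｝ : Fin 6 → Fin 6 → Fin 6 → Subset 6
｛ i , j , k ｝ = ⁅ i ⁆ ∪ ⁅ j ⁆ ∪ ⁅ k ⁆

eightTimes fourTimes : List (Subset 6)
eightTimes = ｛ 0F , 3F , 4F ｝ ∷ ｛ 1F , 2F , 3F ｝ ∷ ｛ 1F , 2F , 5F ｝ ∷ ｛ 1F , 4F , 5F ｝ ∷ []
fourTimes  = ｛ 0F , 2F , 3F ｝ ∷ ｛ 0F , 2F , 5F ｝ ∷ ｛ 0F , 4F , 5F ｝ ∷ ｛ 1F , 3F , 4F ｝ ∷ []

Remaining : Subset 6 → Set
Remaining S = ThreeElement S × S ∉ eightTimes × S ∉ fourTimes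

-- Exactly n subsets satisfy P.
HasSize : (Subset 6 → Set) → ℕ → Set
HasSize P n = ∃[ L ] Unique L × length L ≡ n × (∀ S → S ∈ L ⇔ P S)

UniformOutput : Set
UniformOutput = ∀ S → ThreeElement S → outputProbability S ≡ + 1 ℚ./ 20

{-# OPTIONS --safe #-}
module Submission where

open import Defs
open import Data.List.Membership.Propositional using (_∈_)
open import Data.Product using (_×_)
open import Relation.Binary.PropositionalEquality using (_≡_)
open import Relation.Nullary using (¬_)

open import Data.Bool using (true; false)
open import Data.Fin.Patterns using (1F; 2F; 3F)
open import Data.Fin.Properties using (all?)
open import Data.Fin.Subset using (Subset; ∣_∣)
open import Data.Integer using (+_)
open import Data.List using (List; []; _∷_; [_]; map; _++_; filter; length)
import Data.List.Membership.DecPropositional as DecMembership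
open import Data.List.Membership.Propositional.Properties
  using (∈-filter⁺; ∈-filter⁻; ∈-map⁺; ∈-++⁺ˡ; ∈-++⁺ʳ)
import Data.List.Relation.Unary.All as All
open import Data.List.Relation.Unary.Any using (here)
import Data.List.Relation.Unary.Unique.DecPropositional as DecUnique
open import Data.Nat using (zero; suc; _≟_)
open import Data.Product using (_,_; proj₂)
import Data.Rational as ℚ
open import Data.Vec using ([]; _∷_)
open import Function.Bundles using (mk⇔)
open import Relation.Binary.PropositionalEquality using (refl)
open import Relation.Nullary.Decidable using (True; toWitness; toWitnessFalse; _×-dec_)
open import Relation.Unary using (Decidable)

open DecMembership _≟ₛ_ using (_∉?_)
open DecUnique _≟ₛ_ using (unique?)

-- Everything is finite, so the proof evaluates decision procedures over the 120 inputs and the 64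
-- subsets; `subsets` and `∈-subsets` turn claims about all `S` into claims about an explicit list.
-- The bias arises in the last round: there `x` is `d` or `d + 2`, with `d` the rank of `a₁` among
-- the first two picks. Given the set of these picks, `d` is uniform, but their order also
-- determines where the displaced items lie. After picks 3, 4 the tail is 2, 0, 1, 5 with `d = 1`;
-- after 4, 3 it is 2, 1, 0, 5 with `d = 0`. So 0 is favoured and 1 never drawn.

subsets : ∀ n → List (Subset n)
subsets zero    = [ [] ]
subsets (suc n) = map (false ∷_) (subsets n) ++ map (true ∷_) (subsets n)

∈-subsets : ∀ {n} (S : Subset n) → S ∈ subsets n
∈-subsets []                 = here refl
∈-subsets (false ∷ S)        = ∈-++⁺ˡ (∈-map⁺ (false ∷_) (∈-subsets S))
∈-subsets {suc n} (true ∷ S) =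
  ∈-++⁺ʳ (map (false ∷_) (subsets n)) (∈-map⁺ (true ∷_) (∈-subsets S))

-- For a concrete `P?` the filtered list evaluates: the implicit argument reduces to the unit type
-- and is filled in automatically, and the length becomes a numeral.
hasSize : ∀ {P} (P? : Decidable P) →
          {True (unique? (filter P? (subsets 6)))} →
          HasSize P (length (filter P? (subsets 6)))
hasSize P? {unique} = filter P? (subsets 6) , toWitness unique , refl , λ S →
  mk⇔ (λ S∈ → proj₂ (∈-filter⁻ P? {xs = subsets 6} S∈)) (∈-filter⁺ P? (∈-subsets S))

threeElement? : Decidable ThreeElement
threeElement? S = ∣ S ∣ ≟ 3

remaining? : Decidable Remaining
remaining? S = threeElement? S ×-dec (S ∉? eightTimes) ×-dec (S ∉? fourTimes)

timesOutput≟ : ∀ n → Decidable (λ S → timesOutput S ≡ n)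
timesOutput≟ n S = timesOutput S ≟ n

-- The expected type supplies `n`; the implicit argument then runs the procedure on all inputs for
-- each entry of `L`.
timesOutput-on : ∀ {n} (L : List (Subset 6)) → {True (All.all? (timesOutput≟ n) L)} →
                 ∀ S → S ∈ L → timesOutput S ≡ n
timesOutput-on L {all} S = All.lookup (toWitness all)

timesOutput-remaining : ∀ S → Remaining S → timesOutput S ≡ 6
timesOutput-remaining S r =
  timesOutput-on (filter remaining? (subsets 6)) S (∈-filter⁺ remaining? (∈-subsets S) r)

¬uniformOutput : ¬ UniformOutput
¬uniformOutput uniform =
  -- `S` is output 8 times, so its probability is 8/120 = 1/15.
  toWitnessFalse {a? = outputProbability S ℚ.≟ (+ 1 ℚ./ 20)} _ (uniform S refl)
  where S = ｛ 1F , 2F , 3F ｝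

mainTheorem5 : (∀ z → ThreeElement (recycledFY z))
    × (∀ S → S ∈ eightTimes → timesOutput S ≡ 8)
    × (∀ S → S ∈ fourTimes → timesOutput S ≡ 4)
    × HasSize Remaining 12
    × (∀ S → Remaining S → timesOutput S ≡ 6)
    × HasSize ThreeElement 20
    × ¬ UniformOutput
mainTheorem5 =
    toWitness {a? = all? (λ z → threeElement? (recycledFY z))} _
  , timesOutput-on eightTimes
  , timesOutput-on fourTimes
  , hasSize remaining?
  , timesOutput-remaining
  , hasSize threeElement?
  , ¬uniformOutput
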